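{- Let $m\ge 2$ and let $\tau=\tau_1\tau_2\cdots\tau_k$ be a partition with exactly $m$ blocks such that $\tau_i=i$ for each $i\in[m-1]$. Then \[\sum_{n\ge0}p_n(12\cdots(m+1),\tau)x^n=\sum_{n\ge0}p_n(12\cdots(m+1))x^n-\left(\frac{x}{1-(m-1)x}\right)^{k-m}\frac{x}{1-mx}\prod_{j=1}^{m-1}\frac{x}{1-jx}.\] In particular this generating function depends only on $k$ and $m$, not on $\tau$ itself.
   Context: Set partitions of $[n]$ are represented by canonical sequential forms (restricted growth words): $\pi=\pi_1\cdots\pi_n$ with $\pi_1=1$, $\pi_{i+1}\le\max(\pi_1,\dots,\pi_i)+1$, where $\pi_j$ is the index of the block containing $j$ and blocks are ordered by their minima; the empty partition is the unique partition of $[0]$. $\pi$ contains a pattern $\tau$ if some subsequence of $\pi$ is order-isomorphic to $\tau$, and avoids it otherwise. $p_n(T)$ denotes the number of partitions of $[n]$ avoiding all patterns in $T$. -}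

module Defs where

open import Data.Fin.Base using (Fin; zero; suc; toℕ; cast)
open import Data.Fin.Properties using (all?)
open import Data.Integer.Base as ℤ using (ℤ; +_; 0ℤ; 1ℤ)
import Data.Integer.Properties as ℤ
open import Data.List.Base
  using (List; []; _∷_; length; lookup; map; filter; foldr; concatMap; applyUpTo; deduplicate)
import Data.List.Properties as List
open import Data.List.Membership.Propositional using (_∈_; find; lose)
open import Data.List.Membership.Propositional.Properties
open import Data.List.Relation.Binary.Sublist.Propositional using (_⊆_; []; _∷_; _∷ʳ_)
open import Data.List.Relation.Binary.Disjoint.Propositional using (Disjoint)
open import Data.List.Relation.Unary.All as All using (All; []; _∷_)
import Data.List.Relation.Unary.All.Properties as All
open import Data.List.Relation.Unary.AllPairs as AllPairs using ([]; _∷_)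
import Data.List.Relation.Unary.AllPairs.Properties as AllPairs
open import Data.List.Relation.Unary.Any using (here)
open import Data.List.Relation.Unary.Unique.Propositional using (Unique)
import Data.List.Relation.Unary.Unique.Propositional.Properties as Unique
open import Data.Nat.Base using (ℕ; zero; suc; _≤_; _<_; _∸_; _⊔_; z≤n; s≤s)
open import Data.Nat.Properties using (_≟_; _≤?_; _<?_; suc-injective; <⇒≢)
open import Data.Product using (Σ-syntax; ∃-syntax; _×_; _,_)
open import Data.Sum.Base using (_⊎_; inj₁; inj₂)
open import Data.Vec.Functional as Vector using (Vector)
open import Function.Base using (_∘_)
open import Function.Bundles using (_⇔_; mk⇔; Equivalence)
open import Relation.Binary.PropositionalEquality
open import Relation.Nullary using (Dec; yes; no; ¬_; ¬?; map′; _×-dec_; _→-dec_; _⊎-dec_)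
open import Relation.Unary using (Decidable)
open import Algebra.Properties.Monoid.Sum ℤ.+-0-monoid using (sum⁺-syntax; sum-cong-≗)

Word : Set
Word = List ℕ

-- The word 1 2 ⋯ n.
increasing : ℕ → Word
increasing = applyUpTo suc

------------------------------------------------------------------------
-- Set partitions as canonical sequential forms

-- RestrictedGrowth b π : every letter of π is positive and exceeds by at
-- most 1 the maximum of b and the letters before it.

data RestrictedGrowth (b : ℕ) : Word → Set where
  []  : RestrictedGrowth b []
  _∷_ : ∀ {a π} → 1 ≤ a × a ≤ suc b →
        RestrictedGrowth (b ⊔ a) π → RestrictedGrowth b (a ∷ π)

-- With b = 0 the first letter, if there is one, must be 1.
IsPartition : Word → Set
IsPartition = RestrictedGrowth 0

-- The j-th letter names the block of j, so the blocks are the distinct letters.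
blocks : Word → ℕ
blocks π = length (deduplicate _≟_ π)

growthWords : ℕ → ℕ → List Word
growthWords b zero    = [] ∷ []
growthWords b (suc n) =
  concatMap (λ a → map (a ∷_) (growthWords (b ⊔ a) n)) (increasing (suc b))

partitions : ℕ → List Word
partitions = growthWords 0

------------------------------------------------------------------------
-- Pattern containment

OrderIsomorphic : Word → Word → Set
OrderIsomorphic σ τ = Σ[ eq ∈ length σ ≡ length τ ] ∀ (i j : Fin (length σ)) →
  lookup σ i < lookup σ j ⇔ lookup τ (cast eq i) < lookup τ (cast eq j)

Contains : Word → Word → Set
Contains π τ = ∃[ σ ] σ ⊆ π × OrderIsomorphic σ τ

Avoids : Word → Word → Set
Avoids π τ = ¬ Contains π τ

orderIsomorphic? : ∀ σ τ → Dec (OrderIsomorphic σ τ)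
orderIsomorphic? σ τ with length σ ≟ length τ
... | no neq = no λ (eq , _) → neq eq
... | yes eq = map′ (eq ,_) irrelevant (all? λ i → all? λ j →
        ⇔-dec (lookup σ i <? lookup σ j) (lookup τ (cast eq i) <? lookup τ (cast eq j)))
  where
  ⇔-dec : ∀ {A B : Set} → Dec A → Dec B → Dec (A ⇔ B)
  ⇔-dec a? b? = map′ (λ (f , g) → mk⇔ f g) (λ e → Equivalence.to e , Equivalence.from e)
                     ((a? →-dec b?) ×-dec (b? →-dec a?))
  irrelevant : OrderIsomorphic σ τ → ∀ i j →
    lookup σ i < lookup σ j ⇔ lookup τ (cast eq i) < lookup τ (cast eq j)
  irrelevant (_ , iso) = iso

anySubsequence? : ∀ {P : Word → Set} → Decidable P → ∀ π → Dec (∃[ σ ] σ ⊆ π × P σ)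
anySubsequence? P? [] = map′ (λ p → [] , [] , p) (λ { (_ , [] , p) → p }) (P? [])
anySubsequence? {P} P? (x ∷ π) =
  map′ to from (anySubsequence? (P? ∘ (x ∷_)) π ⊎-dec anySubsequence? P? π)
  where
  to : (∃[ σ ] σ ⊆ π × P (x ∷ σ)) ⊎ (∃[ σ ] σ ⊆ π × P σ) → ∃[ σ ] σ ⊆ x ∷ π × P σ
  to (inj₁ (σ , s , p)) = x ∷ σ , refl ∷ s , p
  to (inj₂ (σ , s , p)) = σ , x ∷ʳ s , p
  from : ∃[ σ ] σ ⊆ x ∷ π × P σ → (∃[ σ ] σ ⊆ π × P (x ∷ σ)) ⊎ (∃[ σ ] σ ⊆ π × P σ)
  from (_ , refl ∷ s , p) = inj₁ (_ , s , p)
  from (_ , _ ∷ʳ s   , p) = inj₂ (_ , s , p)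

avoids? : ∀ π τ → Dec (Avoids π τ)
avoids? π τ = ¬? (anySubsequence? (λ σ → orderIsomorphic? σ τ) π)

avoidsAll? : ∀ (T : List Word) π → Dec (All (Avoids π) T)
avoidsAll? T π = All.all? (avoids? π) T

p : ℕ → List Word → ℕ
p n T = length (filter (avoidsAll? T) (partitions n))

-- A word with m distinct letters has length at least m, so the truncated
-- subtraction length τ ∸ m is exact for admissible τ.
record Admissible (m : ℕ) (τ : Word) : Set where
  field
    isPartition : IsPartition τ
    hasBlocks   : blocks τ ≡ m
    -- toℕ i + 1 is the position counted from 1.
    initial     : ∀ (i : Fin (length τ)) → suc (toℕ i) ≤ m ∸ 1 → lookup τ i ≡ suc (toℕ i)

------------------------------------------------------------------------
-- Formal power series with integer coefficients

Series : Set
Series = ℕ → ℤ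

infix  4 _≈ₛ_
infixl 6 _-ₛ_
infixl 7 _*ₛ_ _/ₛ_
infixr 8 _^ₛ_

_≈ₛ_ : Series → Series → Set
f ≈ₛ g = ∀ n → f n ≡ g n

const : ℤ → Series
const c zero    = c
const c (suc _) = 0ℤ

X : Series
X 1 = 1ℤ
X _ = 0ℤ

_-ₛ_ : Series → Series → Series
(f -ₛ g) n = f n ℤ.- g n

_*ₛ_ : Series → Series → Series
(f *ₛ g) n = ∑[ i ≤ n ] (f (toℕ i) ℤ.* g (n ∸ toℕ i))

_^ₛ_ : Series → ℕ → Series
f ^ₛ zero  = const 1ℤ
f ^ₛ suc n = f *ₛ f ^ₛ n

-- Coefficients n, n - 1, …, 0 of 1 / f for f with constant term 1, from
-- the recurrence  h (n + 1) = - (f 1 * h n + ⋯ + f (n + 1) * h 0).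
recipCoeffs : Series → ∀ n → Vector ℤ (suc n)
recipCoeffs f zero    = λ _ → 1ℤ
recipCoeffs f (suc n) =
  (ℤ.- (∑[ i ≤ n ] (f (suc (toℕ i)) ℤ.* recipCoeffs f n i))) Vector.∷ recipCoeffs f n

recip : Series → Series
recip f n = recipCoeffs f n zero

-- Meaningful only when g has constant term 1; see *ₛ-recip.
_/ₛ_ : Series → Series → Series
f /ₛ g = f *ₛ recip g

∏ₛ : List ℕ → (ℕ → Series) → Series
∏ₛ js f = foldr (λ j g → f j *ₛ g) (const 1ℤ) js

x/[1-_x] : ℕ → Series
x/[1- j x] = X /ₛ (const 1ℤ -ₛ const (+ j) *ₛ X)

avoiders : List Word → Series
avoiders T n = + p n T

------------------------------------------------------------------------
-- recip is the multiplicative inverse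

recipCoeffs-recip : ∀ f n (i : Fin (suc n)) → recipCoeffs f n i ≡ recip f (n ∸ toℕ i)
recipCoeffs-recip f zero    zero    = refl
recipCoeffs-recip f (suc n) zero    = refl
recipCoeffs-recip f (suc n) (suc i) = recipCoeffs-recip f n i

*ₛ-recip : ∀ f → f 0 ≡ 1ℤ → f *ₛ recip f ≈ₛ const 1ℤ
*ₛ-recip f f₀ zero rewrite f₀ = refl
*ₛ-recip f f₀ (suc n) = begin
  f 0 ℤ.* recip f (suc n) ℤ.+ ∑[ i ≤ n ] (f (suc (toℕ i)) ℤ.* recip f (n ∸ toℕ i))
    ≡⟨ cong₂ ℤ._+_ (trans (cong (ℤ._* recip f (suc n)) f₀) (ℤ.*-identityˡ (recip f (suc n))))
         (sum-cong-≗ {suc n} λ i → cong (f (suc (toℕ i)) ℤ.*_) (sym (recipCoeffs-recip f n i))) ⟩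
  ℤ.- S ℤ.+ S
    ≡⟨ ℤ.+-inverseˡ S ⟩
  0ℤ ∎
  where
  open ≡-Reasoning
  S : ℤ
  S = ∑[ i ≤ n ] (f (suc (toℕ i)) ℤ.* recipCoeffs f n i)

------------------------------------------------------------------------
-- partitions n lists every partition of [n] exactly once

∈-growthWords⁺ : ∀ {b π} → RestrictedGrowth b π → π ∈ growthWords b (length π)
∈-growthWords⁺ [] = here refl
∈-growthWords⁺ {b} (_∷_ {a = suc a} (s≤s _ , a≤) g) =
  ∈-concatMap⁺ (λ a → map (a ∷_) _)
    (lose (∈-applyUpTo⁺ suc a≤) (∈-map⁺ _ (∈-growthWords⁺ g)))

∈-growthWords⁻ : ∀ b n {π} → π ∈ growthWords b n → length π ≡ n × RestrictedGrowth b π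
∈-growthWords⁻ b zero (here refl) = refl , []
∈-growthWords⁻ b (suc n) π∈
  with a , a∈ , π∈′ ← find (∈-concatMap⁻ (λ a → map (a ∷_) (growthWords (b ⊔ a) n)) {xs = increasing (suc b)} π∈)
  with _ , w∈ , refl ← ∈-map⁻ (a ∷_) π∈′
  with i , i< , refl ← ∈-applyUpTo⁻ suc a∈
  with eq , g ← ∈-growthWords⁻ (b ⊔ suc i) n w∈
  = cong suc eq , (s≤s z≤n , i<) ∷ g

growthWords-unique : ∀ b n → Unique (growthWords b n)
growthWords-unique b zero    = [] ∷ []
growthWords-unique b (suc n) = Unique.concat⁺
  (All.map⁺ (All.universal (λ a → Unique.map⁺ List.∷-injectiveʳ (growthWords-unique (b ⊔ a) n)) _))
  (AllPairs.map⁺ (AllPairs.map disjoint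
    (Unique.applyUpTo⁺₁ suc (suc b) λ i<j _ → <⇒≢ i<j ∘ suc-injective)))
  where
  disjoint : ∀ {a c} → a ≢ c →
    Disjoint (map (a ∷_) (growthWords (b ⊔ a) n)) (map (c ∷_) (growthWords (b ⊔ c) n))
  disjoint a≢c (v∈ , v∈′) with _ , _ , refl ← ∈-map⁻ _ v∈ with _ , _ , eq ← ∈-map⁻ _ v∈′ =
    a≢c (List.∷-injectiveˡ eq)

∈-partitions : ∀ n π → π ∈ partitions n ⇔ (length π ≡ n × IsPartition π)
∈-partitions n π = mk⇔ (∈-growthWords⁻ 0 n) λ { (refl , g) → ∈-growthWords⁺ g }

partitions-unique : ∀ n → Unique (partitions n)
partitions-unique = growthWords-unique 0

module Submission where

-- A partition avoids 12⋯(m+1) iff its letters are at most m, and an order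
-- isomorphic copy of τ in such a word must be τ itself, since both sets of
-- letters lie in [m] and τ uses all of it. So the two avoidance counts differ by the
-- number of partitions with letters at most m that have τ as a subsequence. Matching
-- τ greedily from the left: while the maximum so far is b < m - 1, the awaited
-- letter is the new letter b + 1 and there are b others, which gives a factor
-- x / (1 - b x); from maximum m - 1 on, all m letters are available at each
-- place, so each of the remaining k - m + 1 letters of τ contributes
-- x / (1 - (m - 1) x) and the free tail 1 / (1 - m x).

open import Defs
open import Algebra.Bundles using (CommutativeMonoid)
import Algebra.Properties.CommutativeSemigroup as CommutativeSemigroupProperties
open import Data.Bool.Base using (true; false)
open import Data.Fin.Base using (Fin; zero; suc; toℕ; cast)
open import Data.Fin.Properties using (cast-is-id; cast-involutive)
open import Data.Integer.Base as ℤ using (ℤ; +_; 0ℤ; 1ℤ)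
import Data.Integer.Properties as ℤ
open import Algebra.Properties.Monoid.Sum ℤ.+-0-monoid using (sum-cong-≗)
open import Data.Integer.Tactic.RingSolver using (solve-∀)
open import Data.List.Base
  using (List; []; _∷_; _++_; length; lookup; map; filter; concatMap; applyUpTo; deduplicate)
open import Data.List.Membership.Propositional using (_∈_)
open import Data.List.Membership.Propositional.Properties
  using (∈-applyUpTo⁺; ∈-deduplicate⁺; ∈-deduplicate⁻; ∈-lookup)
open import Data.List.Membership.Propositional.Properties.WithK using (unique∧set⇒bag)
open import Data.List.Properties
  using (filter-≐; filter-none; filter-++; length-++; length-applyUpTo; map-applyUpTo; applyUpTo-∷ʳ)
open import Data.List.Relation.Binary.BagAndSetEquality using (∼bag⇒↭)
open import Data.List.Relation.Binary.Permutation.Propositional.Properties using (↭-length)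
open import Data.List.Relation.Binary.Sublist.Propositional
  using (_⊆_; []; _∷_; _∷ʳ_; ⊆-refl; ⊆-trans; minimum) renaming (lookup to ⊆-lookup)
open import Data.List.Relation.Binary.Sublist.Propositional.Properties using (∷⁻; All-resp-⊆; length-mono-≤)
open import Data.List.Relation.Unary.All as All using (All; []; _∷_)
import Data.List.Relation.Unary.All.Properties as All
open import Data.List.Relation.Unary.Any using (index)
open import Data.List.Relation.Unary.Any.Properties using (lookup-index)
import Data.List.Relation.Unary.Unique.Propositional.Properties as Unique
open import Data.Nat.Base using (ℕ; zero; suc; _+_; _*_; _≤_; _<_; _∸_; _⊔_; z≤n; s≤s)
open import Data.Nat.ListAction using (sum)
open import Data.Nat.ListAction.Properties using (sum-++)
open import Data.Nat.Properties
open import Data.List.Relation.Binary.Sublist.DecPropositional _≟_ using (_⊆?_)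
open import Data.List.Relation.Unary.Unique.DecPropositional.Properties _≟_ using (deduplicate-!)
open import Data.Product using (_×_; _,_; proj₁; proj₂; ∃-syntax)
open import Data.Sum.Base using (_⊎_; inj₁; inj₂)
open import Function.Base using (_∘_; id)
open import Function.Bundles using (_⇔_; mk⇔; Equivalence)
open import Level using (0ℓ)
import Relation.Binary.Reasoning.Setoid as SetoidReasoning
open import Relation.Binary.PropositionalEquality
open import Relation.Nullary using (¬_; yes; no; contradiction; does; _×-dec_)
open import Relation.Unary using (Decidable; _≐_)

-- Series under the Cauchy product

tail : Series → Series
tail f = f ∘ suc

*ₛ-cong : ∀ {f f′ g g′} → f ≈ₛ f′ → g ≈ₛ g′ → f *ₛ g ≈ₛ f′ *ₛ g′
*ₛ-cong f≈f′ g≈g′ n = sum-cong-≗ {suc n} λ i → cong₂ ℤ._*_ (f≈f′ (toℕ i)) (g≈g′ (n ∸ toℕ i))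

scale-*ₛ : ∀ c f g n → ((λ k → c ℤ.* f k) *ₛ g) n ≡ c ℤ.* (f *ₛ g) n
scale-*ₛ c f g zero    = lemma c (f 0) (g 0)
  where
  lemma : ∀ c a b → c ℤ.* a ℤ.* b ℤ.+ 0ℤ ≡ c ℤ.* (a ℤ.* b ℤ.+ 0ℤ)
  lemma = solve-∀
scale-*ₛ c f g (suc n) = trans (cong (ℤ._+_ (c ℤ.* f 0 ℤ.* g (suc n))) (scale-*ₛ c (tail f) g n))
                               (lemma c (f 0) (g (suc n)) ((tail f *ₛ g) n))
  where
  lemma : ∀ c a b d → c ℤ.* a ℤ.* b ℤ.+ c ℤ.* d ≡ c ℤ.* (a ℤ.* b ℤ.+ d)
  lemma = solve-∀

+-*ₛ : ∀ f g h n → ((λ k → f k ℤ.+ g k) *ₛ h) n ≡ (f *ₛ h) n ℤ.+ (g *ₛ h) n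
+-*ₛ f g h zero    = lemma (f 0) (g 0) (h 0)
  where
  lemma : ∀ a b c → (a ℤ.+ b) ℤ.* c ℤ.+ 0ℤ ≡ (a ℤ.* c ℤ.+ 0ℤ) ℤ.+ (b ℤ.* c ℤ.+ 0ℤ)
  lemma = solve-∀
+-*ₛ f g h (suc n) = trans (cong (ℤ._+_ ((f 0 ℤ.+ g 0) ℤ.* h (suc n))) (+-*ₛ (tail f) (tail g) h n))
                           (lemma (f 0) (g 0) (h (suc n)) ((tail f *ₛ h) n) ((tail g *ₛ h) n))
  where
  lemma : ∀ a b c d e → (a ℤ.+ b) ℤ.* c ℤ.+ (d ℤ.+ e) ≡ (a ℤ.* c ℤ.+ d) ℤ.+ (b ℤ.* c ℤ.+ e)
  lemma = solve-∀

-- Induction on the degree: by definition `tail (f *ₛ g)` is `f 0` times `tail g` plus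
-- `tail f *ₛ g`, so linearity in the left factor reduces the claim to `tail f`.
*ₛ-assoc : ∀ f g h → (f *ₛ g) *ₛ h ≈ₛ f *ₛ (g *ₛ h)
*ₛ-assoc f g h zero    = lemma (f 0) (g 0) (h 0)
  where
  lemma : ∀ a b c → (a ℤ.* b ℤ.+ 0ℤ) ℤ.* c ℤ.+ 0ℤ ≡ a ℤ.* (b ℤ.* c ℤ.+ 0ℤ) ℤ.+ 0ℤ
  lemma = solve-∀
*ₛ-assoc f g h (suc n) = begin
  (f 0 ℤ.* g 0 ℤ.+ 0ℤ) ℤ.* h (suc n) ℤ.+ (tail (f *ₛ g) *ₛ h) n
    ≡⟨ cong (ℤ._+_ ((f 0 ℤ.* g 0 ℤ.+ 0ℤ) ℤ.* h (suc n))) (+-*ₛ (λ k → f 0 ℤ.* tail g k) (tail f *ₛ g) h n) ⟩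
  (f 0 ℤ.* g 0 ℤ.+ 0ℤ) ℤ.* h (suc n) ℤ.+
    (((λ k → f 0 ℤ.* tail g k) *ₛ h) n ℤ.+ ((tail f *ₛ g) *ₛ h) n)
    ≡⟨ cong (ℤ._+_ ((f 0 ℤ.* g 0 ℤ.+ 0ℤ) ℤ.* h (suc n)))
         (cong₂ ℤ._+_ (scale-*ₛ (f 0) (tail g) h n) (*ₛ-assoc (tail f) g h n)) ⟩
  (f 0 ℤ.* g 0 ℤ.+ 0ℤ) ℤ.* h (suc n) ℤ.+
    (f 0 ℤ.* (tail g *ₛ h) n ℤ.+ (tail f *ₛ (g *ₛ h)) n)
    ≡⟨ lemma (f 0) (g 0) (h (suc n)) ((tail g *ₛ h) n) ((tail f *ₛ (g *ₛ h)) n) ⟩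
  f 0 ℤ.* (g *ₛ h) (suc n) ℤ.+ (tail f *ₛ (g *ₛ h)) n ∎
  where
  open ≡-Reasoning
  lemma : ∀ a b c d e → (a ℤ.* b ℤ.+ 0ℤ) ℤ.* c ℤ.+ (a ℤ.* d ℤ.+ e) ≡ a ℤ.* (b ℤ.* c ℤ.+ d) ℤ.+ e
  lemma = solve-∀

-- The Cauchy sum unfolds by definition at its first term; splitting off the last term instead is
-- the mirror image that commutativity needs.
*ₛ-tailʳ : ∀ f g n → (f *ₛ g) (suc n) ≡ f (suc n) ℤ.* g 0 ℤ.+ (f *ₛ tail g) n
*ₛ-tailʳ f g zero    = lemma (f 0) (g 1) (f 1) (g 0)
  where
  lemma : ∀ a b c d → a ℤ.* b ℤ.+ (c ℤ.* d ℤ.+ 0ℤ) ≡ c ℤ.* d ℤ.+ (a ℤ.* b ℤ.+ 0ℤ)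
  lemma = solve-∀
*ₛ-tailʳ f g (suc n) = trans (cong (ℤ._+_ (f 0 ℤ.* g (suc (suc n)))) (*ₛ-tailʳ (tail f) g n))
  (lemma (f 0 ℤ.* g (suc (suc n))) (f (suc (suc n)) ℤ.* g 0) ((tail f *ₛ tail g) n))
  where
  lemma : ∀ a b c → a ℤ.+ (b ℤ.+ c) ≡ b ℤ.+ (a ℤ.+ c)
  lemma = solve-∀

*ₛ-comm : ∀ f g → f *ₛ g ≈ₛ g *ₛ f
*ₛ-comm f g zero    = cong (ℤ._+ 0ℤ) (ℤ.*-comm (f 0) (g 0))
*ₛ-comm f g (suc n) = trans (cong₂ ℤ._+_ (ℤ.*-comm (f 0) (g (suc n))) (*ₛ-comm (tail f) g n))
                            (sym (*ₛ-tailʳ g f n))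

0-*ₛ : ∀ f g → (∀ n → f n ≡ 0ℤ) → ∀ n → (f *ₛ g) n ≡ 0ℤ
0-*ₛ f g f≡0 zero    = cong (λ a → a ℤ.* g 0 ℤ.+ 0ℤ) (f≡0 0)
0-*ₛ f g f≡0 (suc n) = cong₂ (λ a b → a ℤ.* g (suc n) ℤ.+ b) (f≡0 0) (0-*ₛ (tail f) g (f≡0 ∘ suc) n)

*ₛ-identityˡ : ∀ f → const 1ℤ *ₛ f ≈ₛ f
*ₛ-identityˡ f zero    = trans (ℤ.+-identityʳ _) (ℤ.*-identityˡ (f 0))
*ₛ-identityˡ f (suc n) = trans (cong₂ ℤ._+_ (ℤ.*-identityˡ (f (suc n))) (0-*ₛ (tail (const 1ℤ)) f (λ _ → refl) n))
                               (ℤ.+-identityʳ _)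

*ₛ-commutativeMonoid : CommutativeMonoid 0ℓ 0ℓ
*ₛ-commutativeMonoid = record
  { Carrier = Series
  ; _≈_ = _≈ₛ_
  ; _∙_ = _*ₛ_
  ; ε   = const 1ℤ
  ; isCommutativeMonoid = record
    { isMonoid = record
      { isSemigroup = record
        { isMagma = record
          { isEquivalence = record
            { refl  = λ _ → refl
            ; sym   = λ f≈g n → sym (f≈g n)
            ; trans = λ f≈g g≈h n → trans (f≈g n) (g≈h n)
            }
          ; ∙-cong = *ₛ-cong
          }
        ; assoc = *ₛ-assoc
        }
      ; identity = *ₛ-identityˡ , λ f n → trans (*ₛ-comm f (const 1ℤ) n) (*ₛ-identityˡ f n)
      }
    ; comm = *ₛ-comm
    }
  }

open CommutativeMonoid *ₛ-commutativeMonoid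
  using (commutativeSemigroup)
  renaming (setoid to seriesSetoid; ∙-congˡ to *ₛ-congˡ; ∙-congʳ to *ₛ-congʳ; identityʳ to *ₛ-identityʳ)
open CommutativeSemigroupProperties commutativeSemigroup using (x∙yz≈y∙xz)

X-*ₛ : ∀ f n → (X *ₛ f) (suc n) ≡ f n
X-*ₛ f n = begin
  0ℤ ℤ.* f (suc n) ℤ.+ (tail X *ₛ f) n ≡⟨ ℤ.+-identityˡ _ ⟩
  (tail X *ₛ f) n                      ≡⟨ *ₛ-cong {g = f} tail-X (λ _ → refl) n ⟩
  (const 1ℤ *ₛ f) n                    ≡⟨ *ₛ-identityˡ f n ⟩
  f n                                  ∎
  where
  open ≡-Reasoning
  tail-X : tail X ≈ₛ const 1ℤ
  tail-X zero    = refl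
  tail-X (suc _) = refl

-- Reciprocals of 1 - j x and first-order recurrences

1-_x : ℕ → Series
1- j x = const 1ℤ -ₛ const (+ j) *ₛ X

tail-1-jx : ∀ j n → (1- j x) (suc n) ≡ ℤ.- (+ j) ℤ.* const 1ℤ n
tail-1-jx j n = begin
  0ℤ ℤ.- (const (+ j) *ₛ X) (suc n) ≡⟨ cong (λ a → 0ℤ ℤ.- a) (*ₛ-comm (const (+ j)) X (suc n)) ⟩
  0ℤ ℤ.- (X *ₛ const (+ j)) (suc n) ≡⟨ cong (λ a → 0ℤ ℤ.- a) (X-*ₛ (const (+ j)) n) ⟩
  0ℤ ℤ.- const (+ j) n              ≡⟨ lemma n ⟩
  ℤ.- (+ j) ℤ.* const 1ℤ n          ∎
  where
  open ≡-Reasoning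
  lemma₁ : ∀ a → 0ℤ ℤ.- a ≡ ℤ.- a ℤ.* 1ℤ
  lemma₁ = solve-∀
  lemma : ∀ n → 0ℤ ℤ.- const (+ j) n ≡ ℤ.- (+ j) ℤ.* const 1ℤ n
  lemma zero    = lemma₁ (+ j)
  lemma (suc n) = sym (ℤ.*-zeroʳ (ℤ.- (+ j)))

-- Beyond its constant term 1, the series `1- j x` has only the coefficient -j, so coefficient n + 1
-- of `*ₛ-recip` becomes the recurrence of a geometric series.
recip-1-jx : ∀ j n → recip (1- j x) (suc n) ≡ + j ℤ.* recip (1- j x) n
recip-1-jx j n = begin
  r (suc n)
    ≡⟨ lemma (+ j) (r (suc n)) (r n) ⟩
  (1ℤ ℤ.* r (suc n) ℤ.+ ℤ.- (+ j) ℤ.* r n) ℤ.+ + j ℤ.* r n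
    ≡⟨ cong (λ a → (a ℤ.+ ℤ.- (+ j) ℤ.* r n) ℤ.+ + j ℤ.* r n)
         (cong (ℤ._* r (suc n)) (sym 1-jx-0)) ⟩
  ((1- j x) 0 ℤ.* r (suc n) ℤ.+ ℤ.- (+ j) ℤ.* r n) ℤ.+ + j ℤ.* r n
    ≡⟨ cong (λ a → ((1- j x) 0 ℤ.* r (suc n) ℤ.+ a) ℤ.+ + j ℤ.* r n) (sym tail-*ₛ) ⟩
  ((1- j x) *ₛ r) (suc n) ℤ.+ + j ℤ.* r n
    ≡⟨ cong (ℤ._+ + j ℤ.* r n) (*ₛ-recip (1- j x) 1-jx-0 (suc n)) ⟩
  0ℤ ℤ.+ + j ℤ.* r n
    ≡⟨ ℤ.+-identityˡ _ ⟩
  + j ℤ.* r n ∎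
  where
  open ≡-Reasoning
  r : Series
  r = recip (1- j x)
  1-jx-0 : (1- j x) 0 ≡ 1ℤ
  1-jx-0 = cong (λ a → 1ℤ ℤ.- (a ℤ.+ 0ℤ)) (ℤ.*-zeroʳ (+ j))
  tail-*ₛ : (tail (1- j x) *ₛ r) n ≡ ℤ.- (+ j) ℤ.* r n
  tail-*ₛ = begin
    (tail (1- j x) *ₛ r) n                        ≡⟨ *ₛ-cong {g = r} (tail-1-jx j) (λ _ → refl) n ⟩
    ((λ k → ℤ.- (+ j) ℤ.* const 1ℤ k) *ₛ r) n     ≡⟨ scale-*ₛ (ℤ.- (+ j)) (const 1ℤ) r n ⟩
    ℤ.- (+ j) ℤ.* (const 1ℤ *ₛ r) n               ≡⟨ cong (ℤ.- (+ j) ℤ.*_) (*ₛ-identityˡ r n) ⟩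
    ℤ.- (+ j) ℤ.* r n                             ∎
  lemma : ∀ j a b → a ≡ (1ℤ ℤ.* a ℤ.+ ℤ.- j ℤ.* b) ℤ.+ j ℤ.* b
  lemma = solve-∀

recip-1-jx-unique : ∀ j f → f 0 ≡ 1ℤ → (∀ n → f (suc n) ≡ + j ℤ.* f n) → f ≈ₛ recip (1- j x)
recip-1-jx-unique j f f₀ f₊ zero    = f₀
recip-1-jx-unique j f f₀ f₊ (suc n) = begin
  f (suc n)                  ≡⟨ f₊ n ⟩
  + j ℤ.* f n                ≡⟨ cong (+ j ℤ.*_) (recip-1-jx-unique j f f₀ f₊ n) ⟩
  + j ℤ.* recip (1- j x) n   ≡⟨ recip-1-jx j n ⟨
  recip (1- j x) (suc n)     ∎
  where open ≡-Reasoning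

-- The hypotheses say that (1 - j x) f = x g. This turns each recurrence for a count into one factor
-- of the product formula.
x/[1-jx]-unique : ∀ j f g → f 0 ≡ 0ℤ → (∀ n → f (suc n) ≡ + j ℤ.* f n ℤ.+ g n) → f ≈ₛ x/[1- j x] *ₛ g
x/[1-jx]-unique j f g f₀ f₊ n = trans (expand n) (sym (*ₛ-assoc X r g n))
  where
  open ≡-Reasoning
  r : Series
  r = recip (1- j x)
  tail-f : ∀ n → f (suc n) ≡ (r *ₛ g) n
  tail-f zero    = begin
    f 1                       ≡⟨ f₊ 0 ⟩
    + j ℤ.* f 0 ℤ.+ g 0       ≡⟨ cong (λ a → + j ℤ.* a ℤ.+ g 0) f₀ ⟩
    + j ℤ.* 0ℤ ℤ.+ g 0        ≡⟨ lemma (+ j) (g 0) ⟩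
    1ℤ ℤ.* g 0 ℤ.+ 0ℤ         ∎
    where
    lemma : ∀ a b → a ℤ.* 0ℤ ℤ.+ b ≡ 1ℤ ℤ.* b ℤ.+ 0ℤ
    lemma = solve-∀
  tail-f (suc n) = begin
    f (suc (suc n))                                  ≡⟨ f₊ (suc n) ⟩
    + j ℤ.* f (suc n) ℤ.+ g (suc n)                  ≡⟨ cong (λ a → + j ℤ.* a ℤ.+ g (suc n)) (tail-f n) ⟩
    + j ℤ.* (r *ₛ g) n ℤ.+ g (suc n)                 ≡⟨ lemma (+ j ℤ.* (r *ₛ g) n) (g (suc n)) ⟩
    1ℤ ℤ.* g (suc n) ℤ.+ + j ℤ.* (r *ₛ g) n          ≡⟨ cong (ℤ._+_ (1ℤ ℤ.* g (suc n))) (scale-*ₛ (+ j) r g n) ⟨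
    1ℤ ℤ.* g (suc n) ℤ.+ ((λ k → + j ℤ.* r k) *ₛ g) n
      ≡⟨ cong (ℤ._+_ (1ℤ ℤ.* g (suc n))) (*ₛ-cong {g = g} (recip-1-jx j) (λ _ → refl) n) ⟨
    1ℤ ℤ.* g (suc n) ℤ.+ (tail r *ₛ g) n             ∎
    where
    lemma : ∀ a b → a ℤ.+ b ≡ 1ℤ ℤ.* b ℤ.+ a
    lemma = solve-∀
  expand : f ≈ₛ X *ₛ (r *ₛ g)
  expand zero    = f₀
  expand (suc n) = trans (tail-f n) (sym (X-*ₛ (r *ₛ g) n))

-- Counting growth words by their first letter

sum-const : ∀ f n {c} → (∀ i → i < n → f i ≡ c) → sum (applyUpTo f n) ≡ n * c
sum-const f zero    f≡c = refl
sum-const f (suc n) f≡c = cong₂ _+_ (f≡c 0 (s≤s z≤n)) (sum-const (f ∘ suc) n λ i i<n → f≡c (suc i) (s≤s i<n))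

-- In the counts below, the exceptional index is the awaited letter; every other admissible first
-- letter contributes the same amount.
sum-const-except : ∀ f n {c} j → j ≤ n → (∀ i → i ≤ n → i ≢ j → f i ≡ c) →
                   sum (applyUpTo f (suc n)) ≡ n * c + f j
sum-const-except f n {c} zero j≤n f≡c =
  trans (cong (_+_ (f 0)) (sum-const (f ∘ suc) n λ i i<n → f≡c (suc i) i<n λ ())) (+-comm (f 0) (n * c))
sum-const-except f (suc n) {c} (suc j) (s≤s j≤n) f≡c = begin
  f 0 + sum (applyUpTo (f ∘ suc) (suc n))
    ≡⟨ cong₂ _+_ (f≡c 0 z≤n λ ())
         (sum-const-except (f ∘ suc) n j j≤n λ i i≤n i≢j → f≡c (suc i) (s≤s i≤n) (i≢j ∘ suc-injective)) ⟩
  c + (n * c + f (suc j))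
    ≡⟨ +-assoc c (n * c) (f (suc j)) ⟨
  suc n * c + f (suc j) ∎
  where open ≡-Reasoning

sum-last : ∀ f n → sum (applyUpTo f (suc n)) ≡ sum (applyUpTo f n) + f n
sum-last f n = begin
  sum (applyUpTo f (suc n))              ≡⟨ cong sum (applyUpTo-∷ʳ f n) ⟨
  sum (applyUpTo f n ++ f n ∷ [])        ≡⟨ sum-++ (applyUpTo f n) (f n ∷ []) ⟩
  sum (applyUpTo f n) + (f n + 0)        ≡⟨ cong (_+_ (sum (applyUpTo f n))) (+-identityʳ (f n)) ⟩
  sum (applyUpTo f n) + f n              ∎
  where open ≡-Reasoning

count : {P : Word → Set} → Decidable P → List Word → ℕ
count P? ws = length (filter P? ws)

count-≐ : ∀ {P Q} (P? : Decidable P) (Q? : Decidable Q) → P ≐ Q → ∀ ws → count P? ws ≡ count Q? ws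
count-≐ P? Q? P≐Q ws = cong length (filter-≐ P? Q? P≐Q ws)

module _ {P : Word → Set} (P? : Decidable P) where

  count-none : (∀ w → ¬ P w) → ∀ ws → count P? ws ≡ 0
  count-none ¬P ws = cong length (filter-none P? (All.universal ¬P ws))

  count-map : ∀ (f : Word → Word) ws → count P? (map f ws) ≡ count (P? ∘ f) ws
  count-map f []       = refl
  count-map f (w ∷ ws) with does (P? (f w))
  ... | true  = cong suc (count-map f ws)
  ... | false = count-map f ws

  count-concatMap : ∀ {A : Set} (f : A → List Word) xs →
                    count P? (concatMap f xs) ≡ sum (map (count P? ∘ f) xs)
  count-concatMap f []       = refl
  count-concatMap f (x ∷ xs) = begin
    count P? (f x ++ concatMap f xs)
      ≡⟨ cong length (filter-++ P? (f x) (concatMap f xs)) ⟩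
    length (filter P? (f x) ++ filter P? (concatMap f xs))
      ≡⟨ length-++ (filter P? (f x)) ⟩
    count P? (f x) + count P? (concatMap f xs)
      ≡⟨ cong (_+_ (count P? (f x))) (count-concatMap f xs) ⟩
    count P? (f x) + sum (map (count P? ∘ f) xs) ∎
    where open ≡-Reasoning

  count-growthWords-suc : ∀ b n → count P? (growthWords b (suc n)) ≡
    sum (applyUpTo (λ i → count (P? ∘ (suc i ∷_)) (growthWords (b ⊔ suc i) n)) (suc b))
  count-growthWords-suc b n = begin
    count P? (growthWords b (suc n))
      ≡⟨ count-concatMap (λ a → map (a ∷_) (growthWords (b ⊔ a) n)) (increasing (suc b)) ⟩
    sum (map (λ a → count P? (map (a ∷_) (growthWords (b ⊔ a) n))) (increasing (suc b)))
      ≡⟨ cong sum (map-applyUpTo suc _ (suc b)) ⟩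
    sum (applyUpTo (λ i → count P? (map (suc i ∷_) (growthWords (b ⊔ suc i) n))) (suc b))
      ≡⟨ cong sum (applyUpTo-cong (λ i → count-map (suc i ∷_) (growthWords (b ⊔ suc i) n)) (suc b)) ⟩
    sum (applyUpTo (λ i → count (P? ∘ (suc i ∷_)) (growthWords (b ⊔ suc i) n)) (suc b)) ∎
    where
    open ≡-Reasoning
    applyUpTo-cong : ∀ {f g : ℕ → ℕ} → f ≗ g → ∀ n → applyUpTo f n ≡ applyUpTo g n
    applyUpTo-cong f≗g zero    = refl
    applyUpTo-cong f≗g (suc n) = cong₂ _∷_ (f≗g 0) (applyUpTo-cong (f≗g ∘ suc) n)

-- Occurrences of a word, counted by greedy matching

-- For a partition w and a pattern τ with m blocks, this amounts to avoiding 12⋯(m+1) and containing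
-- τ. In this form both conditions can be tested letter by letter.
Occurs : ℕ → Word → Word → Set
Occurs m τ w = All (_≤ m) w × τ ⊆ w

occurs? : ∀ m τ → Decidable (Occurs m τ)
occurs? m τ w = All.all? (_≤? m) w ×-dec (τ ⊆? w)

module _ {m : ℕ} where

  -- Greedy matching loses nothing: an occurrence of `a ∷ τ` that bypasses the first `a` still
  -- leaves τ inside the rest of the word.
  count-occurs-match : ∀ {a} τ → a ≤ m → ∀ ws →
    count (occurs? m (a ∷ τ) ∘ (a ∷_)) ws ≡ count (occurs? m τ) ws
  count-occurs-match {a} τ a≤m = count-≐ (occurs? m (a ∷ τ) ∘ (a ∷_)) (occurs? m τ)
    ( (λ { (_ ∷ w≤m , s) → w≤m , ∷⁻ s })
    , (λ (w≤m , s) → a≤m ∷ w≤m , refl ∷ s) )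

  count-occurs-skip : ∀ {a t} τ → a ≤ m → a ≢ t → ∀ ws →
    count (occurs? m (t ∷ τ) ∘ (a ∷_)) ws ≡ count (occurs? m (t ∷ τ)) ws
  count-occurs-skip {a} {t} τ a≤m a≢t = count-≐ (occurs? m (t ∷ τ) ∘ (a ∷_)) (occurs? m (t ∷ τ))
    ( (λ { (_ ∷ w≤m , _ ∷ʳ s) → w≤m , s
         ; (_ ∷ w≤m , refl ∷ s) → contradiction refl a≢t })
    , (λ (w≤m , s) → a≤m ∷ w≤m , a ∷ʳ s) )

  count-occurs-[] : ∀ {a} → a ≤ m → ∀ ws →
    count (occurs? m [] ∘ (a ∷_)) ws ≡ count (occurs? m []) ws
  count-occurs-[] {a} a≤m = count-≐ (occurs? m [] ∘ (a ∷_)) (occurs? m [])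
    ( (λ { (_ ∷ w≤m , _ ∷ʳ s) → w≤m , s })
    , (λ (w≤m , s) → a≤m ∷ w≤m , a ∷ʳ s) )

  count-occurs-large : ∀ {a} τ → m < a → ∀ ws → count (occurs? m τ ∘ (a ∷_)) ws ≡ 0
  count-occurs-large {a} τ m<a = count-none (occurs? m τ ∘ (a ∷_)) λ { _ (a≤m ∷ _ , _) → <⇒≱ m<a a≤m }

-- The number of words of length n over m + 1 letters that have the subsequence
-- τ; it depends on τ only through length τ.
superwords : ℕ → Word → ℕ → ℕ
superwords m []      zero    = 1
superwords m []      (suc n) = suc m * superwords m [] n
superwords m (t ∷ τ) zero    = 0
superwords m (t ∷ τ) (suc n) = m * superwords m (t ∷ τ) n + superwords m τ n

Letter : ℕ → ℕ → Set
Letter m a = 1 ≤ a × a ≤ m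

-- Once all letters up to m have appeared, the letters 1, …, m + 1 are all
-- allowed and larger ones are excluded, so the word continues freely.
count-saturated : ∀ {m b τ} → m ≤ b → b ≤ suc m → All (Letter (suc m)) τ → ∀ n →
  count (occurs? (suc m) τ) (growthWords b n) ≡ superwords m τ n
count-saturated {τ = []}    m≤b b≤m τ-ok zero = refl
count-saturated {τ = _ ∷ _} m≤b b≤m τ-ok zero = refl
count-saturated {m} {b} {τ} m≤b b≤m τ-ok (suc n) =
  trans (count-growthWords-suc (occurs? (suc m) τ) b n)
    (trans (drop-last (m≤n⇒m<n∨m≡n b≤m)) (recurrence τ τ-ok))
  where
  term : Word → ℕ → ℕ
  term τ i = count (occurs? (suc m) τ ∘ (suc i ∷_)) (growthWords (b ⊔ suc i) n)
  -- Here b is m or m + 1. In the first case the next letter ranges over 1, ..., m + 1 already; in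
  -- the second it may also be m + 2, which exceeds the bound and contributes 0.
  drop-last : b < suc m ⊎ b ≡ suc m →
              sum (applyUpTo (term τ) (suc b)) ≡ sum (applyUpTo (term τ) (suc m))
  drop-last (inj₁ b≤m) = cong (λ b → sum (applyUpTo (term τ) (suc b))) (≤-antisym (≤-pred b≤m) m≤b)
  drop-last (inj₂ refl) = trans (sum-last (term τ) (suc m))
    (trans (cong (_+_ (sum (applyUpTo (term τ) (suc m))))
             (count-occurs-large τ (n<1+n (suc m)) (growthWords (suc m ⊔ suc (suc m)) n)))
           (+-identityʳ _))
  -- A letter of at most m + 1 keeps the maximum in {m, m + 1}, so the induction hypothesis applies
  -- after every such letter.
  continue : ∀ {i τ} → i ≤ m → All (Letter (suc m)) τ →
             count (occurs? (suc m) τ) (growthWords (b ⊔ suc i) n) ≡ superwords m τ n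
  continue i≤m τ-ok = count-saturated (≤-trans m≤b (m≤m⊔n b _)) (⊔-lub b≤m (s≤s i≤m)) τ-ok n
  recurrence : ∀ τ → All (Letter (suc m)) τ → sum (applyUpTo (term τ) (suc m)) ≡ superwords m τ (suc n)
  recurrence []          τ-ok = sum-const (term []) (suc m) λ i i≤m →
    trans (count-occurs-[] i≤m (growthWords (b ⊔ suc i) n)) (continue (≤-pred i≤m) τ-ok)
  recurrence (zero ∷ τ)  ((() , _) ∷ _)
  recurrence (suc t ∷ τ) τ-ok@((_ , s≤s t≤m) ∷ τ-ok′) = trans
    (sum-const-except (term (suc t ∷ τ)) m t t≤m λ i i≤m i≢t →
      trans (count-occurs-skip τ (s≤s i≤m) (i≢t ∘ suc-injective) (growthWords (b ⊔ suc i) n)) (continue i≤m τ-ok))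
    (cong (_+_ (m * superwords m (suc t ∷ τ) n))
      (trans (count-occurs-match τ (s≤s t≤m) (growthWords (b ⊔ suc t) n)) (continue t≤m τ-ok′)))

-- Each of the b old letters leaves both the maximum and the awaited letter unchanged; the only
-- other choice, b + 1, matches and raises the maximum.
count-ascending : ∀ {m b τ} → suc b ≤ m → ∀ n →
  count (occurs? m (suc b ∷ τ)) (growthWords b (suc n)) ≡
  b * count (occurs? m (suc b ∷ τ)) (growthWords b n) + count (occurs? m τ) (growthWords (suc b) n)
count-ascending {m} {b} {τ} b<m n = begin
  count (occurs? m (suc b ∷ τ)) (growthWords b (suc n))
    ≡⟨ count-growthWords-suc (occurs? m (suc b ∷ τ)) b n ⟩
  sum (applyUpTo term (suc b))
    ≡⟨ sum-const-except term b b ≤-refl below ⟩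
  b * count (occurs? m (suc b ∷ τ)) (growthWords b n) + term b
    ≡⟨ cong (_+_ (b * count (occurs? m (suc b ∷ τ)) (growthWords b n)))
         (trans (count-occurs-match τ b<m (growthWords (b ⊔ suc b) n))
           (cong (λ c → count (occurs? m τ) (growthWords c n)) (m≤n⇒m⊔n≡n (n≤1+n b)))) ⟩
  b * count (occurs? m (suc b ∷ τ)) (growthWords b n) + count (occurs? m τ) (growthWords (suc b) n) ∎
  where
  open ≡-Reasoning
  term : ℕ → ℕ
  term i = count (occurs? m (suc b ∷ τ) ∘ (suc i ∷_)) (growthWords (b ⊔ suc i) n)
  below : ∀ i → i ≤ b → i ≢ b → term i ≡ count (occurs? m (suc b ∷ τ)) (growthWords b n)
  below i i≤b i≢b = trans
    (count-occurs-skip τ (≤-trans (s≤s i≤b) b<m) (i≢b ∘ suc-injective) (growthWords (b ⊔ suc i) n))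
    (cong (λ c → count (occurs? m (suc b ∷ τ)) (growthWords c n)) (m≥n⇒m⊔n≡m (≤∧≢⇒< i≤b i≢b)))

-- Generating functions of the occurrence counts

continuations : ℕ → ℕ → Word → Series
continuations m b τ n = + count (occurs? m τ) (growthWords b n)

+-recurrence : ∀ j a b → + (j * a + b) ≡ + j ℤ.* + a ℤ.+ + b
+-recurrence j a b = cong (ℤ._+ + b) (ℤ.pos-* j a)

-- Every letter of τ gives one factor by `x/[1-jx]-unique`; once τ is used up, the free words over m
-- + 1 letters give the geometric series.
superwords-series : ∀ m τ → (λ n → + superwords m τ n) ≈ₛ x/[1- m x] ^ₛ length τ *ₛ recip (1- suc m x)
superwords-series m [] n = trans
  (recip-1-jx-unique (suc m) (λ n → + superwords m [] n) refl (λ n → ℤ.pos-* (suc m) (superwords m [] n)) n)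
  (sym (*ₛ-identityˡ (recip (1- suc m x)) n))
superwords-series m (t ∷ τ) = begin
  (λ n → + superwords m (t ∷ τ) n)
    ≈⟨ x/[1-jx]-unique m (λ n → + superwords m (t ∷ τ) n) (λ n → + superwords m τ n) refl
         (λ n → +-recurrence m (superwords m (t ∷ τ) n) (superwords m τ n)) ⟩
  x/[1- m x] *ₛ (λ n → + superwords m τ n)
    ≈⟨ *ₛ-congˡ {x/[1- m x]} (superwords-series m τ) ⟩
  x/[1- m x] *ₛ (x/[1- m x] ^ₛ length τ *ₛ recip (1- suc m x))
    ≈⟨ *ₛ-assoc x/[1- m x] (x/[1- m x] ^ₛ length τ) (recip (1- suc m x)) ⟨
  x/[1- m x] ^ₛ length (t ∷ τ) *ₛ recip (1- suc m x) ∎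
  where open SetoidReasoning seriesSetoid

continuations-ascending : ∀ {m b} τ → suc b ≤ m →
  continuations m b (suc b ∷ τ) ≈ₛ x/[1- b x] *ₛ continuations m (suc b) τ
continuations-ascending {m} {b} τ b<m =
  x/[1-jx]-unique b (continuations m b (suc b ∷ τ)) (continuations m (suc b) τ) refl λ n →
    trans (cong +_ (count-ascending b<m n))
      (+-recurrence b (count (occurs? m (suc b ∷ τ)) (growthWords b n)) _)

-- The word b + 1, ..., b + d. Carrying b as an argument keeps the recursion in step with the
-- maximum of the word read so far.
upFrom : ℕ → ℕ → Word
upFrom b zero    = []
upFrom b (suc d) = suc b ∷ upFrom (suc b) d

-- The spare factor X turns the recip (1- suc m x) of superwords-series into x/[1- suc m x].
X-*ₛ-continuations : ∀ {m l ρ} → All (Letter (suc m)) ρ → length ρ ≡ suc l →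
  ∀ d b → suc b + d ≡ m →
  X *ₛ continuations (suc m) (suc b) (upFrom (suc b) d ++ ρ) ≈ₛ
  ∏ₛ (upFrom b (suc d)) x/[1-_x] *ₛ (x/[1- m x] ^ₛ l *ₛ x/[1- suc m x])
X-*ₛ-continuations {m} {l} {ρ} ρ-ok len zero b b+0≡m with refl ← trans (sym b+0≡m) (+-identityʳ (suc b)) = begin
  X *ₛ continuations (suc m) m ρ
    ≈⟨ *ₛ-congˡ {X} (λ n → cong +_ (count-saturated ≤-refl (n≤1+n m) ρ-ok n)) ⟩
  X *ₛ (λ n → + superwords m ρ n)
    ≈⟨ *ₛ-congˡ {X} (superwords-series m ρ) ⟩
  X *ₛ (A ^ₛ length ρ *ₛ R)
    -- Of the l + 1 factors `A` contributed by ρ, one is set aside as the last factor, j = m, of the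
    -- product.
    ≡⟨ cong (λ k → X *ₛ (A ^ₛ k *ₛ R)) len ⟩
  X *ₛ ((A *ₛ A ^ₛ l) *ₛ R)
    ≈⟨ x∙yz≈y∙xz X (A *ₛ A ^ₛ l) R ⟩
  (A *ₛ A ^ₛ l) *ₛ (X *ₛ R)
    ≈⟨ *ₛ-assoc A (A ^ₛ l) (X *ₛ R) ⟩
  A *ₛ (A ^ₛ l *ₛ x/[1- suc m x])
    ≈⟨ *ₛ-congʳ {A ^ₛ l *ₛ x/[1- suc m x]} (*ₛ-identityʳ A) ⟨
  (A *ₛ const 1ℤ) *ₛ (A ^ₛ l *ₛ x/[1- suc m x]) ∎
  where
  open SetoidReasoning seriesSetoid
  A R : Series
  A = x/[1- m x]
  R = recip (1- suc m x)
X-*ₛ-continuations {m} {l} {ρ} ρ-ok len (suc d) b b+d≡m = begin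
  X *ₛ continuations (suc m) (suc b) (suc (suc b) ∷ τ)
    ≈⟨ *ₛ-congˡ {X} (continuations-ascending τ b<m) ⟩
  X *ₛ (x/[1- suc b x] *ₛ continuations (suc m) (suc (suc b)) τ)
    ≈⟨ x∙yz≈y∙xz X x/[1- suc b x] (continuations (suc m) (suc (suc b)) τ) ⟩
  x/[1- suc b x] *ₛ (X *ₛ continuations (suc m) (suc (suc b)) τ)
    ≈⟨ *ₛ-congˡ {x/[1- suc b x]} (X-*ₛ-continuations ρ-ok len d (suc b) (trans (sym (+-suc (suc b) d)) b+d≡m)) ⟩
  x/[1- suc b x] *ₛ (∏ₛ (upFrom (suc b) (suc d)) x/[1-_x] *ₛ H)
    ≈⟨ *ₛ-assoc x/[1- suc b x] (∏ₛ (upFrom (suc b) (suc d)) x/[1-_x]) H ⟨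
  ∏ₛ (upFrom b (suc (suc d))) x/[1-_x] *ₛ H ∎
  where
  open SetoidReasoning seriesSetoid
  τ : Word
  τ = upFrom (suc (suc b)) d ++ ρ
  H : Series
  H = x/[1- m x] ^ₛ l *ₛ x/[1- suc m x]
  b<m : suc (suc b) ≤ suc m
  b<m = s≤s (subst (suc b ≤_) b+d≡m (m≤m+n (suc b) (suc d)))

continuations-series : ∀ {m l ρ} → All (Letter (suc (suc m))) ρ → length ρ ≡ suc l →
  continuations (suc (suc m)) 0 (upFrom 0 (suc m) ++ ρ) ≈ₛ
  x/[1- suc m x] ^ₛ l *ₛ x/[1- suc (suc m) x] *ₛ ∏ₛ (upFrom 0 (suc m)) x/[1-_x]
continuations-series {m} {l} {ρ} ρ-ok len = begin
  continuations (suc (suc m)) 0 (1 ∷ τ)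
    ≈⟨ continuations-ascending τ (s≤s z≤n) ⟩
  x/[1- 0 x] *ₛ W
    -- At the start there are no old letters, so the first letter contributes x alone; this is the
    -- spare factor `X`.
    ≈⟨ x/[1-jx]-unique 0 (X *ₛ W) W refl (λ n → trans (X-*ₛ W n) (sym (ℤ.+-identityˡ (W n)))) ⟨
  X *ₛ W
    ≈⟨ X-*ₛ-continuations ρ-ok len m 0 refl ⟩
  ∏ₛ (upFrom 0 (suc m)) x/[1-_x] *ₛ H
    ≈⟨ *ₛ-comm (∏ₛ (upFrom 0 (suc m)) x/[1-_x]) H ⟩
  H *ₛ ∏ₛ (upFrom 0 (suc m)) x/[1-_x] ∎
  where
  open SetoidReasoning seriesSetoid
  τ : Word
  τ = upFrom 1 m ++ ρ
  H W : Series
  H = x/[1- suc m x] ^ₛ l *ₛ x/[1- suc (suc m) x]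
  W = continuations (suc (suc m)) 1 τ

-- Pattern containment in canonical sequential forms

upFrom-applyUpTo : ∀ f b d → (∀ i → f i ≡ suc (b + i)) → applyUpTo f d ≡ upFrom b d
upFrom-applyUpTo f b zero    f≡ = refl
upFrom-applyUpTo f b (suc d) f≡ = cong₂ _∷_
  (trans (f≡ 0) (cong suc (+-identityʳ b)))
  (upFrom-applyUpTo (f ∘ suc) (suc b) d λ i → trans (f≡ (suc i)) (cong suc (+-suc b i)))

increasing≡upFrom : ∀ d → increasing d ≡ upFrom 0 d
increasing≡upFrom d = upFrom-applyUpTo suc 0 d λ _ → refl

length-upFrom : ∀ b d → length (upFrom b d) ≡ d
length-upFrom b zero    = refl
length-upFrom b (suc d) = cong suc (length-upFrom (suc b) d)

applyUpTo-⊆ : ∀ {A : Set} (f : ℕ → A) {m n} → m ≤ n → applyUpTo f m ⊆ applyUpTo f n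
applyUpTo-⊆ f z≤n       = minimum _
applyUpTo-⊆ f (s≤s m≤n) = refl ∷ applyUpTo-⊆ (f ∘ suc) m≤n

-- The letters that raise the maximum are b + 1, b + 2, ... in turn and form the subsequence; d
-- counts them, and every other letter is at most the maximum so far.
growth-letters : ∀ {b π} → RestrictedGrowth b π → ∃[ d ] upFrom b d ⊆ π × All (Letter (b + d)) π
growth-letters [] = 0 , [] , []
growth-letters {b} {a ∷ π} ((1≤a , a≤1+b) ∷ g) with m≤n⇒m<n∨m≡n a≤1+b
... | inj₁ (s≤s a≤b) rewrite m≥n⇒m⊔n≡m a≤b with d , s , π-ok ← growth-letters g =
  d , a ∷ʳ s , (1≤a , ≤-trans a≤b (m≤m+n b d)) ∷ π-ok
... | inj₂ refl rewrite m≤n⇒m⊔n≡n (n≤1+n b) with d , s , π-ok ← growth-letters g rewrite sym (+-suc b d) =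
  suc d , refl ∷ s , (1≤a , ≤-trans (s≤s (m≤m+n b d)) (≤-reflexive (sym (+-suc b d)))) ∷ π-ok

-- The facts about a partition with d blocks on which containment rests: `initials` exhibits
-- increasing patterns, and having exactly the letters 1, ..., d makes order isomorphic copies
-- literal.
record Full (d : ℕ) (π : Word) : Set where
  field
    initials : increasing d ⊆ π
    letters  : All (Letter d) π

  surjective : ∀ {u} → Letter d u → u ∈ π
  surjective {suc u} (_ , u<d) = ⊆-lookup initials (∈-applyUpTo⁺ suc u<d)

open Full

partition-full : ∀ {π} → IsPartition π → ∃[ d ] Full d π
partition-full {π} g with d , s , π-ok ← growth-letters g =
  d , record { initials = subst (_⊆ π) (sym (increasing≡upFrom d)) s ; letters = π-ok }

increasing-full : ∀ d → Full d (increasing d)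
increasing-full d = record
  { initials = ⊆-refl
  ; letters  = All.applyUpTo⁺₁ suc d λ i<d → s≤s z≤n , i<d
  }

-- The deduplicated word and `increasing d` are both free of repetitions and have the same elements,
-- hence are permutations of each other.
blocks-full : ∀ {d π} → Full d π → blocks π ≡ d
blocks-full {d} {π} full = trans
  (↭-length (∼bag⇒↭ (unique∧set⇒bag (deduplicate-! π)
    (Unique.applyUpTo⁺₁ suc d λ i<j _ → <⇒≢ i<j ∘ suc-injective)
    (mk⇔ to from))))
  (length-applyUpTo suc d)
  where
  to : ∀ {u} → u ∈ deduplicate _≟_ π → u ∈ increasing d
  to u∈ with All.lookup (letters full) (∈-deduplicate⁻ _≟_ π u∈)
  ... | s≤s _ , u<d = ∈-applyUpTo⁺ suc u<d
  from : ∀ {u} → u ∈ increasing d → u ∈ deduplicate _≟_ π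
  from u∈ = ∈-deduplicate⁺ _≟_ (⊆-lookup (initials full) u∈)

-- Order isomorphic copies of a full word

lookup-ext : ∀ {A : Set} (xs ys : List A) (eq : length xs ≡ length ys) →
  (∀ i → lookup xs i ≡ lookup ys (cast eq i)) → xs ≡ ys
lookup-ext []       []       eq h = refl
lookup-ext (x ∷ xs) (y ∷ ys) eq h =
  cong₂ _∷_ (h zero) (lookup-ext xs ys (suc-injective eq) (h ∘ suc))

orderIsomorphic-refl : ∀ τ → OrderIsomorphic τ τ
orderIsomorphic-refl τ = refl , λ i j →
  subst₂ (λ k l → (lookup τ i < lookup τ j) ⇔ (lookup τ k < lookup τ l))
    (sym (cast-is-id refl i)) (sym (cast-is-id refl j)) (mk⇔ id id)

module _ {d τ} (full : Full d τ) (σ : Word) (σ≅τ : OrderIsomorphic σ τ) where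

  private
    eq : length σ ≡ length τ
    eq = proj₁ σ≅τ

    iso : ∀ i j → (lookup σ i < lookup σ j) ⇔ (lookup τ (cast eq i) < lookup τ (cast eq j))
    iso = proj₂ σ≅τ

    τ-at : Fin (length σ) → ℕ
    τ-at i = lookup τ (cast eq i)

    τ-letter : ∀ i → Letter d (τ-at i)
    τ-letter i = All.lookup (letters full) (∈-lookup (cast eq i))

  letter-position : ∀ {u} → Letter d u → ∃[ i ] τ-at i ≡ u
  letter-position u-ok = cast (sym eq) (index u∈) ,
    trans (cong (lookup τ) (cast-involutive eq (sym eq) (index u∈))) (sym (lookup-index u∈))
    where u∈ = surjective full u-ok

  -- Below a letter v of τ lie the letters 1, …, v - 1, above it v + 1, …, d;
  -- the corresponding chains in σ push its letter up to v and down to v.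

  iso-lower : All (1 ≤_) σ → ∀ v i → τ-at i ≡ v → v ≤ lookup σ i
  iso-lower 1≤σ zero          i eqᵢ = z≤n
  iso-lower 1≤σ (suc zero)    i eqᵢ = All.lookup 1≤σ (∈-lookup i)
  iso-lower 1≤σ (suc (suc v)) i eqᵢ =
    let i′ , eqᵢ′ = letter-position {suc v}
          (s≤s z≤n , ≤-trans (n≤1+n _) (subst (_≤ d) eqᵢ (proj₂ (τ-letter i))))
    in ≤-trans (s≤s (iso-lower 1≤σ (suc v) i′ eqᵢ′))
               (Equivalence.from (iso i′ i) (≤-reflexive (trans (cong suc eqᵢ′) (sym eqᵢ))))

  iso-upper : All (_≤ d) σ → ∀ e i → τ-at i + e ≡ d → lookup σ i + e ≤ d
  iso-upper σ≤d zero    i eqᵢ = subst (_≤ d) (sym (+-identityʳ (lookup σ i))) (All.lookup σ≤d (∈-lookup i))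
  iso-upper σ≤d (suc e) i eqᵢ
    with i′ , eqᵢ′ ← letter-position {suc (τ-at i)}
      (s≤s z≤n , subst (suc (τ-at i) ≤_) (trans (sym (+-suc (τ-at i) e)) eqᵢ) (m≤m+n _ e)) = begin
    lookup σ i + suc e   ≡⟨ +-suc (lookup σ i) e ⟩
    suc (lookup σ i) + e ≤⟨ +-monoˡ-≤ e (Equivalence.from (iso i i′) (≤-reflexive (sym eqᵢ′))) ⟩
    lookup σ i′ + e      ≤⟨ iso-upper σ≤d e i′ (trans (cong (_+ e) eqᵢ′) (trans (sym (+-suc (τ-at i) e)) eqᵢ)) ⟩
    d                    ∎
    where open ≤-Reasoning

  -- The two chains pin each letter of σ to the letter of τ at the same position.
  iso-full⇒≡ : All (Letter d) σ → σ ≡ τ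
  iso-full⇒≡ σ-ok = lookup-ext σ τ eq λ i → ≤-antisym
    (+-cancelʳ-≤ (d ∸ τ-at i) (lookup σ i) (τ-at i)
      (subst (lookup σ i + (d ∸ τ-at i) ≤_) (sym (gap i)) (iso-upper (All.map proj₂ σ-ok) (d ∸ τ-at i) i (gap i))))
    (iso-lower (All.map proj₁ σ-ok) (τ-at i) i refl)
    where
    gap : ∀ i → τ-at i + (d ∸ τ-at i) ≡ d
    gap i = m+[n∸m]≡n (proj₂ (τ-letter i))

⊆⇒contains : ∀ {π τ} → τ ⊆ π → Contains π τ
⊆⇒contains {τ = τ} s = τ , s , orderIsomorphic-refl τ

full-contained⇒⊆ : ∀ {d π τ} → Full d τ → All (Letter d) π → Contains π τ → τ ⊆ π
full-contained⇒⊆ {π = π} full π-ok (σ , s , iso) = subst (_⊆ π) (iso-full⇒≡ full σ iso (All-resp-⊆ s π-ok)) s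

-- In a copy of 12⋯(m+1), the letter in the place of m + 1 has m distinct positive letters below it,
-- so it would exceed m.
avoids-increasing⁺ : ∀ {m π} → All (Letter m) π → Avoids π (increasing (suc m))
avoids-increasing⁺ {m} π-ok (σ , s , iso)
  with i , eqᵢ ← letter-position (increasing-full (suc m)) σ iso {suc m} (s≤s z≤n , ≤-refl) =
  <⇒≱ (iso-lower (increasing-full (suc m)) σ iso (All.map proj₁ σ-ok) (suc m) i eqᵢ)
      (proj₂ (All.lookup σ-ok (∈-lookup i)))
  where σ-ok = All-resp-⊆ s π-ok

-- With d > m blocks, the subsequence 12⋯d of the partition would begin with 12⋯(m+1).
avoids-increasing⁻ : ∀ {m π} → IsPartition π → Avoids π (increasing (suc m)) → All (Letter m) π
avoids-increasing⁻ {m} g avoids with d , full ← partition-full g with d ≤? m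
... | yes d≤m = All.map (λ (1≤a , a≤d) → 1≤a , ≤-trans a≤d d≤m) (letters full)
... | no  d≰m = contradiction
  (⊆⇒contains (⊆-trans (applyUpTo-⊆ suc (≰⇒> d≰m)) (initials full))) avoids

-- Splitting the avoidance count

module _ {P Q R : Word → Set} (P? : Decidable P) (Q? : Decidable Q) (R? : Decidable R) where

  count-⊎ : ∀ {ws} → All (λ w → (P w ⇔ (Q w ⊎ R w)) × (Q w → ¬ R w)) ws →
            count P? ws ≡ count Q? ws + count R? ws
  count-⊎ {[]}     [] = refl
  count-⊎ {w ∷ ws} ((P⇔Q⊎R , disjoint) ∷ rest) with P? w | Q? w | R? w
  ... | yes p | yes q | yes r = contradiction r (disjoint q)
  ... | yes p | yes q | no ¬r = cong suc (count-⊎ rest)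
  ... | yes p | no ¬q | yes r = trans (cong suc (count-⊎ rest)) (sym (+-suc (count Q? ws) (count R? ws)))
  ... | no ¬p | no ¬q | no ¬r = count-⊎ rest
  ... | no ¬p | yes q | _     = contradiction (Equivalence.from P⇔Q⊎R (inj₁ q)) ¬p
  ... | no ¬p | no ¬q | yes r = contradiction (Equivalence.from P⇔Q⊎R (inj₂ r)) ¬p
  ... | yes p | no ¬q | no ¬r with Equivalence.to P⇔Q⊎R p
  ...   | inj₁ q = contradiction q ¬q
  ...   | inj₂ r = contradiction r ¬r

-- Partitions avoiding 12⋯(m+1) are sorted by whether they contain τ; their letters lie in [m], so
-- containing τ means having τ itself as a subsequence.
p-increasing : ∀ {m τ} → Full m τ → ∀ n →
  p n (increasing (suc m) ∷ []) ≡
  p n (increasing (suc m) ∷ τ ∷ []) + count (occurs? m τ) (partitions n)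
p-increasing {m} {τ} full n = count-⊎
  (avoidsAll? (increasing (suc m) ∷ [])) (avoidsAll? (increasing (suc m) ∷ τ ∷ [])) (occurs? m τ)
  (All.tabulate λ {w} w∈ → split (proj₂ (∈-growthWords⁻ 0 n w∈)))
  where
  split : ∀ {w} → IsPartition w →
    (All (Avoids w) (increasing (suc m) ∷ []) ⇔ (All (Avoids w) (increasing (suc m) ∷ τ ∷ []) ⊎ Occurs m τ w))
    × (All (Avoids w) (increasing (suc m) ∷ τ ∷ []) → ¬ Occurs m τ w)
  split {w} g = mk⇔ to from , λ { (_ ∷ ¬c ∷ []) (_ , s) → ¬c (⊆⇒contains s) }
    where
    to : All (Avoids w) (increasing (suc m) ∷ []) → All (Avoids w) (increasing (suc m) ∷ τ ∷ []) ⊎ Occurs m τ w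
    to (avoids ∷ []) with τ ⊆? w
    ... | yes s = inj₂ (All.map proj₂ (avoids-increasing⁻ g avoids) , s)
    ... | no ¬s = inj₁ (avoids ∷ ¬s ∘ full-contained⇒⊆ full (avoids-increasing⁻ g avoids) ∷ [])
    from : All (Avoids w) (increasing (suc m) ∷ τ ∷ []) ⊎ Occurs m τ w → All (Avoids w) (increasing (suc m) ∷ [])
    from (inj₁ (avoids ∷ _)) = avoids ∷ []
    -- `Occurs` bounds the letters only from above; positivity comes from w being a partition.
    from (inj₂ (w≤m , _))    = avoids-increasing⁺ (All.zip (All.map proj₁ (letters (proj₂ (partition-full g))) , w≤m)) ∷ []

avoiders-increasing : ∀ {m τ} → Full m τ →
  avoiders (increasing (suc m) ∷ τ ∷ []) ≈ₛ avoiders (increasing (suc m) ∷ []) -ₛ continuations m 0 τ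
avoiders-increasing {m} {τ} full n rewrite p-increasing full n =
  lemma (+ p n (increasing (suc m) ∷ τ ∷ [])) (+ count (occurs? m τ) (partitions n))
  where
  lemma : ∀ a b → a ≡ (a ℤ.+ b) ℤ.- b
  lemma = solve-∀

-- Admissible patterns and the final formula

split-initial : ∀ d b τ → d ≤ length τ → (∀ i → suc (toℕ i) ≤ d → lookup τ i ≡ suc (b + toℕ i)) →
  ∃[ ρ ] τ ≡ upFrom b d ++ ρ
split-initial zero    b τ       d≤  h = τ , refl
split-initial (suc d) b (t ∷ τ) (s≤s d≤) h
  with ρ , eq ← split-initial d (suc b) τ d≤ (λ i i≤ → trans (h (suc i) (s≤s i≤)) (cong suc (+-suc b (toℕ i)))) =
  ρ , cong₂ _∷_ (trans (h zero (s≤s z≤n)) (cong suc (+-identityʳ b))) eq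

admissible-full : ∀ {m τ} → Admissible m τ → Full m τ
admissible-full adm with d , full ← partition-full (Admissible.isPartition adm)
  with refl ← trans (sym (blocks-full full)) (Admissible.hasBlocks adm) = full

-- The prescribed prefix is one letter shorter than the number of blocks, so ρ is one letter longer
-- than the exponent in the formula; the extra letter accounts for the last factor of the product.
admissible-split : ∀ m {τ} → Admissible (suc m) τ →
  ∃[ ρ ] τ ≡ upFrom 0 m ++ ρ × length ρ ≡ suc (length τ ∸ suc m)
admissible-split m {τ} adm = ρ , τ≡ , +-cancelˡ-≡ m _ _ (begin
  m + length ρ                     ≡⟨ cong (_+ length ρ) (length-upFrom 0 m) ⟨
  length (upFrom 0 m) + length ρ   ≡⟨ length-++ (upFrom 0 m) ⟨
  length (upFrom 0 m ++ ρ)         ≡⟨ cong length τ≡ ⟨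
  length τ                         ≡⟨ m+[n∸m]≡n m<length ⟨
  suc m + (length τ ∸ suc m)       ≡⟨ +-suc m _ ⟨
  m + suc (length τ ∸ suc m)       ∎)
  where
  open ≡-Reasoning
  m<length : suc m ≤ length τ
  -- The word 12⋯(m+1) is a subsequence of τ, so τ is long enough for the truncated subtraction to
  -- be exact.
  m<length = subst (_≤ length τ) (length-applyUpTo suc (suc m)) (length-mono-≤ (initials (admissible-full adm)))
  decomposition : ∃[ ρ ] τ ≡ upFrom 0 m ++ ρ
  decomposition = split-initial m 0 τ (≤-trans (n≤1+n m) m<length) (Admissible.initial adm)
  ρ : Word
  ρ = proj₁ decomposition
  τ≡ : τ ≡ upFrom 0 m ++ ρ
  τ≡ = proj₂ decomposition

avoiders-admissible : ∀ m τ → Admissible (suc (suc m)) τ →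
  avoiders (increasing (suc (suc (suc m))) ∷ τ ∷ [])
    ≈ₛ avoiders (increasing (suc (suc (suc m))) ∷ [])
         -ₛ x/[1- suc m x] ^ₛ (length τ ∸ suc (suc m)) *ₛ x/[1- suc (suc m) x] *ₛ ∏ₛ (increasing (suc m)) x/[1-_x]
avoiders-admissible m τ adm n with ρ , τ≡ , len ← admissible-split (suc m) adm = begin
  avoiders (increasing (suc (suc (suc m))) ∷ τ ∷ []) n
    ≡⟨ avoiders-increasing full n ⟩
  N ℤ.- continuations (suc (suc m)) 0 τ n
    ≡⟨ cong (λ σ → N ℤ.- continuations (suc (suc m)) 0 σ n) τ≡ ⟩
  N ℤ.- continuations (suc (suc m)) 0 (upFrom 0 (suc m) ++ ρ) n
    ≡⟨ cong (λ a → N ℤ.- a) (continuations-series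
         (All.++⁻ʳ (upFrom 0 (suc m)) (subst (All (Letter (suc (suc m)))) τ≡ (letters full))) len n) ⟩
  N ℤ.- (H *ₛ ∏ₛ (upFrom 0 (suc m)) x/[1-_x]) n
    ≡⟨ cong (λ js → N ℤ.- (H *ₛ ∏ₛ js x/[1-_x]) n) (increasing≡upFrom (suc m)) ⟨
  N ℤ.- (H *ₛ ∏ₛ (increasing (suc m)) x/[1-_x]) n ∎
  where
  open ≡-Reasoning
  full : Full (suc (suc m)) τ
  full = admissible-full adm
  N : ℤ
  N = avoiders (increasing (suc (suc (suc m))) ∷ []) n
  H : Series
  H = x/[1- suc m x] ^ₛ (length τ ∸ suc (suc m)) *ₛ x/[1- suc (suc m) x]

theorem2p8 : ∀ (m : ℕ) → 2 ≤ m →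
    (∀ (τ : Word) → Admissible m τ →
    avoiders (increasing (suc m) ∷ τ ∷ [])
    ≈ₛ avoiders (increasing (suc m) ∷ [])
    -ₛ x/[1- (m ∸ 1) x] ^ₛ (length τ ∸ m) *ₛ x/[1- m x] *ₛ ∏ₛ (increasing (m ∸ 1)) x/[1-_x])
    × (∀ (τ τ′ : Word) → Admissible m τ → Admissible m τ′ → length τ ≡ length τ′ →
    avoiders (increasing (suc m) ∷ τ ∷ []) ≈ₛ avoiders (increasing (suc m) ∷ τ′ ∷ []))
theorem2p8 (suc zero)    (s≤s ())
theorem2p8 (suc (suc m)) _ = avoiders-admissible m , λ τ τ′ adm adm′ len n →
  -- The formula involves τ only through its length, so both patterns give the same value of `rhs`.
  trans (avoiders-admissible m τ adm n)
    (trans (cong (λ k → rhs k n) len) (sym (avoiders-admissible m τ′ adm′ n)))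
  where
  rhs : ℕ → Series
  rhs k = avoiders (increasing (suc (suc (suc m))) ∷ [])
    -ₛ x/[1- suc m x] ^ₛ (k ∸ suc (suc m)) *ₛ x/[1- suc (suc m) x] *ₛ ∏ₛ (increasing (suc m)) x/[1-_x]
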